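{- Let $S=\{(6,5),(0,1),(1,1),(3,3)\}$ with $c_{(3,3)}=2$ and $c_{(6,5)}=c_{(0,1)}=c_{(1,1)}=1$. Then for every $n\ge0$, $$\Delta_n=\frac{N_{S,C}(n,n)-1}{2^{n+1}}.$$ In particular $\Delta_n>0$ for all $n\ge3$.
   Context: A fair coin is flipped $n$ times, producing a sequence $x_1,\dots,x_n\in\{H,T\}$ of independent uniformly random outcomes. Alice's score is the number of indices $i\in\{1,\dots,n-1\}$ with $(x_i,x_{i+1})=(H,H)$; Bob's score is the number of indices $i\in\{1,\dots,n-1\}$ with $(x_i,x_{i+1})=(H,T)$. $\Delta_n$ is the probability that Bob's score strictly exceeds Alice's minus the probability that Alice's score strictly exceeds Bob's. Given finite $S\subset\mathbb Z_{\ge0}^2\setminus\{(0,0)\}$ and positive integers $C=\{c_s\}_{s\in S}$, a colored lattice path is a finite (possibly empty) sequence $((s_1,x_1),\dots,(s_m,x_m))$ with $s_i\in S$ and $x_i\in\{1,\dots,c_{s_i}\}$; its endpoint is $\sum_i s_i$. $N_{S,C}(a,b)$ denotes the number of colored lattice paths with endpoint $(a,b)$. -}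

module Defs where

open import Data.Fin using (Fin; suc; inject₁)
open import Data.Fin.Properties using () renaming (all? to allFin?; _≟_ to _≟ᶠ_)
open import Data.Integer using (ℤ; +_)
open import Data.List using (List; []; _∷_; length; map; filter; concatMap; cartesianProductWith; allFin; upTo)
open import Data.List.Membership.Propositional using (_∈_; lose)
open import Data.List.Membership.Propositional.Properties using (∈-map⁺; ∈-map⁻; ∈-concatMap⁺; ∈-cartesianProductWith⁺; ∈-cartesianProductWith⁻; ∈-allFin; ∈-upTo⁺; ∈-filter⁺; ∈-filter⁻)
open import Data.List.Properties using (∷-injective; length-++; length-map)
open import Data.List.Relation.Binary.Disjoint.Propositional using (Disjoint)
open import Data.List.Relation.Unary.All as All using ([]; _∷_)
open import Data.List.Relation.Unary.All.Properties as Allₚ using ()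
open import Data.List.Relation.Unary.AllPairs as AllPairs using ([]; _∷_)
open import Data.List.Relation.Unary.AllPairs.Properties as AllPairsₚ using ()
open import Data.List.Relation.Unary.Any using (here; there)
open import Data.List.Relation.Unary.Unique.Propositional using (Unique)
open import Data.List.Relation.Unary.Unique.Propositional.Properties as Uniqueₚ using ()
open import Data.Nat using (ℕ; zero; suc; _+_; _^_; _≤_; _<?_; _≟_; s≤s; z≤n; NonZero; nonZero?)
open import Data.Nat.Properties using (m^n≢0; ≤-trans; ≤-reflexive; +-mono-≤; n≢0⇒n>0; m+n≡0⇒m≡0; m+n≡0⇒n≡0; +-commutativeSemigroup)
open import Data.Product using (Σ; _×_; _,_; proj₁; proj₂)
open import Data.Product.Properties using (≡-dec)
open import Data.Rational using (ℚ; _/_; _-_)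
open import Data.Vec using (Vec; []; _∷_; lookup)
open import Data.Vec.Properties using () renaming (∷-injective to ∷-injectiveᵛ)
open import Function using (_⇔_; mk⇔)
open import Level using (0ℓ)
open import Relation.Binary using (DecidableEquality)
open import Relation.Binary.PropositionalEquality using (_≡_; _≢_; refl; sym; trans; cong; cong₂)
open import Relation.Nullary using (yes; no; ¬?; _→-dec_)
open import Relation.Nullary.Decidable using (from-yes)
open import Relation.Unary using (Pred; Decidable)
open import Algebra.Properties.CommutativeSemigroup +-commutativeSemigroup using (interchange)

count : {A : Set} {P : Pred A 0ℓ} → Decidable P → List A → ℕ
count P? xs = length (filter P? xs)

_/2^_ : ℤ → ℕ → ℚ
z /2^ n = _/_ z (2 ^ n) {{m^n≢0 2 n}}

infixl 7 _/2^_

data Coin : Set where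
  H T : Coin

_≟ᶜ_ : DecidableEquality Coin
H ≟ᶜ H = yes refl
H ≟ᶜ T = no λ ()
T ≟ᶜ H = no λ ()
T ≟ᶜ T = yes refl

_≟ᶜᶜ_ : DecidableEquality (Coin × Coin)
_≟ᶜᶜ_ = ≡-dec _≟ᶜ_ _≟ᶜ_

occurrences : Coin × Coin → ∀ {n} → Vec Coin n → ℕ
occurrences p {zero}  x = 0
occurrences p {suc m} x =
  count (λ i → (lookup x (inject₁ i) , lookup x (suc i)) ≟ᶜᶜ p) (allFin m)

alice bob : ∀ {n} → Vec Coin n → ℕ
alice = occurrences (H , H)
bob   = occurrences (H , T)

flips : ∀ n → List (Vec Coin n)
flips zero    = [] ∷ []
flips (suc n) = cartesianProductWith _∷_ (H ∷ T ∷ []) (flips n)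

Pr : ∀ n {P : Pred (Vec Coin n) 0ℓ} → Decidable P → ℚ
Pr n P? = + count P? (flips n) /2^ n

Δ : ℕ → ℚ
Δ n = Pr n (λ x → alice x <? bob x) - Pr n (λ x → bob x <? alice x)

-- `flips n` lists each of the 2 ^ n outcomes exactly once.
∈-flips : ∀ {n} (x : Vec Coin n) → x ∈ flips n
∈-flips []      = here refl
∈-flips (c ∷ x) = ∈-cartesianProductWith⁺ _∷_ (c∈ c) (∈-flips x)
  where
  c∈ : ∀ c → c ∈ H ∷ T ∷ []
  c∈ H = here refl
  c∈ T = there (here refl)

flips-unique : ∀ n → Unique (flips n)
flips-unique zero    = [] ∷ []
flips-unique (suc n) =
  Uniqueₚ.cartesianProductWith⁺ _∷_ ∷-injectiveᵛ (((λ ()) ∷ []) ∷ [] ∷ []) (flips-unique n)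

length-flips : ∀ n → length (flips n) ≡ 2 ^ n
length-flips zero    = refl
length-flips (suc n) = trans (length-++ (map (H ∷_) (flips n))) (cong₂ _+_ (half H)
  (trans (length-++ (map (T ∷_) (flips n))) (cong (_+ 0) (half T))))
  where
  half : ∀ c → length (map (c ∷_) (flips n)) ≡ 2 ^ n
  half c = trans (length-map (c ∷_) (flips n)) (length-flips n)

concatMap-unique : {A B : Set} (f : A → List B) (g : B → A) →
                   (∀ {x y} → y ∈ f x → g y ≡ x) → (∀ x → Unique (f x)) →
                   ∀ {xs} → Unique xs → Unique (concatMap f xs)
concatMap-unique f g inv uf {xs} u = Uniqueₚ.concat⁺
  (Allₚ.map⁺ (All.universal uf xs))
  (AllPairsₚ.map⁺ (AllPairs.map disjoint u))
  where
  disjoint : ∀ {x x′} → x ≢ x′ → Disjoint (f x) (f x′)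
  disjoint x≢x′ (y∈ , y∈′) = x≢x′ (trans (sym (inv y∈)) (inv y∈′))

_≟²_ : DecidableEquality (ℕ × ℕ)
_≟²_ = ≡-dec _≟_ _≟_

-- The finite set S is listed without repetition as `step`; `colors` lists the
-- numbers c_s in the same order.
record ColoredSteps : Set where
  field
    size     : ℕ
    step     : Vec (ℕ × ℕ) size
    colors   : Vec ℕ size
    distinct : ∀ i j → lookup step i ≡ lookup step j → i ≡ j
    nonzero  : ∀ i → lookup step i ≢ (0 , 0)
    positive : ∀ i → NonZero (lookup colors i)

module _ (S : ColoredSteps) where
  open ColoredSteps S

  ColoredStep : Set
  ColoredStep = Σ (Fin size) λ i → Fin (lookup colors i)

  Path : Set
  Path = List ColoredStep

  endpoint : Path → ℕ × ℕ
  endpoint []            = 0 , 0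
  endpoint ((i , _) ∷ p) =
    proj₁ (lookup step i) + proj₁ (endpoint p) , proj₂ (lookup step i) + proj₂ (endpoint p)

  coloredSteps : List ColoredStep
  coloredSteps = concatMap (λ i → map (i ,_) (allFin (lookup colors i))) (allFin size)

  pathsOfLength : ℕ → List Path
  pathsOfLength zero    = [] ∷ []
  pathsOfLength (suc m) = cartesianProductWith _∷_ coloredSteps (pathsOfLength m)

  -- Every step raises the coordinate sum by at least 1, so a path ending at
  -- (a , b) has at most a + b steps.
  pathsTo : ℕ → ℕ → List Path
  pathsTo a b =
    filter (λ p → endpoint p ≟² (a , b)) (concatMap pathsOfLength (upTo (suc (a + b))))

  N : ℕ → ℕ → ℕ
  N a b = length (pathsTo a b)

  coloredSteps-unique : Unique coloredSteps
  coloredSteps-unique = concatMap-unique _ proj₁ inv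
    (λ i → Uniqueₚ.map⁺ (λ { refl → refl }) (Uniqueₚ.allFin⁺ _)) (Uniqueₚ.allFin⁺ size)
    where
    inv : ∀ {i} {s : ColoredStep} → s ∈ map (i ,_) (allFin (lookup colors i)) → proj₁ s ≡ i
    inv s∈ with _ , _ , refl ← ∈-map⁻ _ s∈ = refl

  ∈-coloredSteps : ∀ s → s ∈ coloredSteps
  ∈-coloredSteps (i , x) =
    ∈-concatMap⁺ (λ i → map (i ,_) (allFin (lookup colors i)))
      (lose (∈-allFin i) (∈-map⁺ (i ,_) (∈-allFin x)))

  pathsOfLength-unique : ∀ m → Unique (pathsOfLength m)
  pathsOfLength-unique zero    = [] ∷ []
  pathsOfLength-unique (suc m) = Uniqueₚ.cartesianProductWith⁺ _∷_ ∷-injective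
    coloredSteps-unique (pathsOfLength-unique m)

  ∈-pathsOfLength : ∀ p → p ∈ pathsOfLength (length p)
  ∈-pathsOfLength []      = here refl
  ∈-pathsOfLength (s ∷ p) = ∈-cartesianProductWith⁺ _∷_ (∈-coloredSteps s) (∈-pathsOfLength p)

  pathsOfLength⇒length : ∀ {m p} → p ∈ pathsOfLength m → length p ≡ m
  pathsOfLength⇒length {zero}  (here refl) = refl
  pathsOfLength⇒length {suc m} p∈
    with _ , _ , _ , q∈ , refl ← ∈-cartesianProductWith⁻ _∷_ coloredSteps (pathsOfLength m) p∈
    = cong suc (pathsOfLength⇒length q∈)

  step-positive : ∀ i → 1 ≤ proj₁ (lookup step i) + proj₂ (lookup step i)
  step-positive i = n≢0⇒n>0 λ eq →
    nonzero i (cong₂ _,_ (m+n≡0⇒m≡0 _ eq) (m+n≡0⇒n≡0 (proj₁ (lookup step i)) eq))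

  length≤ : ∀ p → length p ≤ proj₁ (endpoint p) + proj₂ (endpoint p)
  length≤ []            = z≤n
  length≤ ((i , _) ∷ p) = ≤-trans (+-mono-≤ (step-positive i) (length≤ p))
    (≤-reflexive (interchange (proj₁ (lookup step i)) _ _ _))

  -- `pathsTo a b` lists exactly the paths ending at (a , b), each once, so
  -- `N a b` is their number.
  ∈-pathsTo : ∀ {a b} p → p ∈ pathsTo a b ⇔ endpoint p ≡ (a , b)
  ∈-pathsTo {a} {b} p = mk⇔
    (λ p∈ → proj₂ (∈-filter⁻ (λ p → endpoint p ≟² (a , b)) {xs = all} p∈))
    (λ { refl → ∈-filter⁺ (λ p → endpoint p ≟² (a , b))
           (∈-concatMap⁺ pathsOfLength
             (lose (∈-upTo⁺ (s≤s (length≤ p))) (∈-pathsOfLength p))) refl })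
    where
    all : List Path
    all = concatMap pathsOfLength (upTo (suc (a + b)))

  pathsTo-unique : ∀ a b → Unique (pathsTo a b)
  pathsTo-unique a b = Uniqueₚ.filter⁺ (λ p → endpoint p ≟² (a , b))
    (concatMap-unique pathsOfLength length pathsOfLength⇒length pathsOfLength-unique
      (Uniqueₚ.upTo⁺ (suc (a + b))))

S₀ : ColoredSteps
S₀ = record
  { size     = 4
  ; step     = step
  ; colors   = colors
  ; distinct = from-yes (allFin? λ i → allFin? λ j → (lookup step i ≟² lookup step j) →-dec (i ≟ᶠ j))
  ; nonzero  = from-yes (allFin? λ i → ¬? (lookup step i ≟² (0 , 0)))
  ; positive = from-yes (allFin? λ i → nonZero? (lookup colors i))
  }
  where
  step : Vec (ℕ × ℕ) 4
  step = (6 , 5) ∷ (0 , 1) ∷ (1 , 1) ∷ (3 , 3) ∷ []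
  colors : Vec ℕ 4
  colors = 1 ∷ 1 ∷ 1 ∷ 2 ∷ []

{-# OPTIONS --safe #-}

-- A nontrivial tie is a word, other than T…T, that ends in T and has equal scores.
-- Appending a flip shows by induction that Bob's wins exceed Alice's by the number R
-- of nontrivial ties of length n: the induction closes because R is also the number of
-- words that end in H with Bob exactly one ahead. Counting runs of heads gives
-- R = ∑_{r ≥ 1} C(2r-1, r-1) C(n-2r, r) in both cases. On the other side, a path to
-- (n , n) with m steps other than (1,1) has n - 2m steps in all, and encoding
-- (6,5), (0,1) and the two colours of (3,3) by 11, 00 and 01, 10 turns its m other steps
-- into 2m bits, m of them ones; so N(n, n) = ∑_m C(2m, m) C(n-2m, m) = 1 + 2 R.

module Submission where

open import Defs
open import Data.Nat using (ℕ; _+_; _≥_)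
open import Data.Integer using (+_; 1ℤ) renaming (_-_ to _-ℤ_)
open import Data.Rational using (0ℚ; _<_)
open import Data.Product using (_×_)
open import Relation.Binary.PropositionalEquality using (_≡_)

open import Data.Bool using (true; false; if_then_else_)
open import Data.Fin using (Fin; zero; suc; inject₁)
open import Data.Integer using () renaming (_+_ to _+ℤ_; _*_ to _*ℤ_; -_ to -ℤ_)
import Data.Integer.Properties as ℤ
import Data.Integer.Tactic.RingSolver as ℤ-Solver
open import Data.List using (List; []; _∷_; _++_; map; length; concatMap; cartesianProductWith; upTo; tabulate; allFin)
open import Data.List.Membership.Propositional using (_∈_)
open import Data.List.Membership.Propositional.Properties using (∈-upTo⁻)
open import Data.List.Properties using (map-++; map-∘; map-upTo; map-tabulate)
open import Data.List.Relation.Unary.Any using (here; there)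
open import Data.Nat using (zero; suc; _*_; _∸_; _^_; _≤_; z≤n; s≤s; s≤s⁻¹; NonZero; _≟_; _<?_) renaming (_<_ to _<ℕ_)
open import Data.Nat.Combinatorics using (_C_; nCk+nC[k+1]≡[n+1]C[k+1]; nCk≡nC[n∸k]; nC1≡n; nCn≡1)
open import Data.Nat.ListAction using (sum)
open import Data.Nat.ListAction.Properties using (sum-++)
open import Data.Nat.Properties hiding (_≟_; _<?_)
open import Data.Nat.Tactic.RingSolver using (solve-∀)
open import Data.Product using (_,_; proj₁; proj₂)
open import Data.Rational using (_/_; _-_; toℚᵘ) renaming (-_ to -ℚ_)
import Data.Rational.Properties as ℚ
open import Data.Rational.Unnormalised using (mkℚᵘ; *≡*) renaming (_+_ to _+ᵘ_; -_ to -ᵘ_)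
import Data.Rational.Unnormalised.Properties as ℚᵘ
open import Data.Vec using (Vec; []; _∷_; lookup)
open import Function using (_∘_; id)
open import Level using (0ℓ)
open import Relation.Binary.PropositionalEquality using (refl; sym; trans; cong; cong₂; subst; module ≡-Reasoning)
open import Relation.Nullary using (Dec; yes; no; does; contradiction)
open import Relation.Unary using (Pred; Decidable)
open import Algebra.Properties.CommutativeSemigroup +-commutativeSemigroup using () renaming (interchange to +-interchange)
open ≡-Reasoning

private variable
  A B : Set

-- Indicators of decidable propositions

⟦_⟧ : {P : Set} → Dec P → ℕ
⟦ d ⟧ = if does d then 1 else 0

⟦⟧-× : {P Q R : Set} (p? : Dec P) (q? : Dec Q) (r? : Dec R) →
       (P → Q × R) → (Q → R → P) → ⟦ p? ⟧ ≡ ⟦ q? ⟧ * ⟦ r? ⟧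
⟦⟧-× (yes p) (yes _) (yes _) _ _ = refl
⟦⟧-× (yes p) (no ¬q) _       f _ = contradiction (proj₁ (f p)) ¬q
⟦⟧-× (yes p) (yes _) (no ¬r) f _ = contradiction (proj₂ (f p)) ¬r
⟦⟧-× (no ¬p) (yes q) (yes r) _ g = contradiction (g q r) ¬p
⟦⟧-× (no _)  (yes _) (no _)  _ _ = refl
⟦⟧-× (no _)  (no _)  _       _ _ = refl

⟦≟⟧-sym : ∀ i j → ⟦ i ≟ j ⟧ ≡ ⟦ j ≟ i ⟧
⟦≟⟧-sym zero    zero    = refl
⟦≟⟧-sym zero    (suc j) = refl
⟦≟⟧-sym (suc i) zero    = refl
⟦≟⟧-sym (suc i) (suc j) = ⟦≟⟧-sym i j

-- Finite sums

∑ : List A → (A → ℕ) → ℕ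
∑ xs f = sum (map f xs)

∑-cong-∈ : (xs : List A) {f g : A → ℕ} → (∀ {x} → x ∈ xs → f x ≡ g x) → ∑ xs f ≡ ∑ xs g
∑-cong-∈ []       eq = refl
∑-cong-∈ (x ∷ xs) eq = cong₂ _+_ (eq (here refl)) (∑-cong-∈ xs (eq ∘ there))

∑-cong : (xs : List A) {f g : A → ℕ} → (∀ x → f x ≡ g x) → ∑ xs f ≡ ∑ xs g
∑-cong xs eq = ∑-cong-∈ xs λ {x} _ → eq x

∑-zero : (xs : List A) {f : A → ℕ} → (∀ x → f x ≡ 0) → ∑ xs f ≡ 0
∑-zero []       eq = refl
∑-zero (x ∷ xs) eq = cong₂ _+_ (eq x) (∑-zero xs eq)

∑-+ : (xs : List A) (f g : A → ℕ) → ∑ xs (λ x → f x + g x) ≡ ∑ xs f + ∑ xs g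
∑-+ []       f g = refl
∑-+ (x ∷ xs) f g = trans (cong (_+_ (f x + g x)) (∑-+ xs f g)) (+-interchange (f x) (g x) _ _)

∑-*ˡ : (xs : List A) (c : ℕ) (f : A → ℕ) → ∑ xs (λ x → c * f x) ≡ c * ∑ xs f
∑-*ˡ []       c f = sym (*-zeroʳ c)
∑-*ˡ (x ∷ xs) c f = trans (cong (_+_ (c * f x)) (∑-*ˡ xs c f)) (sym (*-distribˡ-+ c (f x) _))

∑-swap : (xs : List A) (ys : List B) (f : A → B → ℕ) →
         ∑ xs (λ x → ∑ ys (f x)) ≡ ∑ ys (λ y → ∑ xs (λ x → f x y))
∑-swap []       ys f = sym (∑-zero ys λ _ → refl)
∑-swap (x ∷ xs) ys f = trans (cong (_+_ (∑ ys (f x))) (∑-swap xs ys f)) (sym (∑-+ ys (f x) _))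

∑-++ : (xs ys : List A) (f : A → ℕ) → ∑ (xs ++ ys) f ≡ ∑ xs f + ∑ ys f
∑-++ xs ys f = trans (cong sum (map-++ f xs ys)) (sum-++ (map f xs) (map f ys))

∑-map : (g : A → B) (xs : List A) (f : B → ℕ) → ∑ (map g xs) f ≡ ∑ xs (f ∘ g)
∑-map g xs f = cong sum (sym (map-∘ xs))

∑-concatMap : (g : A → List B) (xs : List A) (f : B → ℕ) →
              ∑ (concatMap g xs) f ≡ ∑ xs (λ x → ∑ (g x) f)
∑-concatMap g []       f = refl
∑-concatMap g (x ∷ xs) f =
  trans (∑-++ (g x) (concatMap g xs) f) (cong (_+_ (∑ (g x) f)) (∑-concatMap g xs f))

∑-cartesianProductWith : {C : Set} (g : A → B → C) (xs : List A) (ys : List B) (f : C → ℕ) →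
  ∑ (cartesianProductWith g xs ys) f ≡ ∑ xs (λ x → ∑ ys (λ y → f (g x y)))
∑-cartesianProductWith g []       ys f = refl
∑-cartesianProductWith g (x ∷ xs) ys f = trans (∑-++ (map (g x) ys) _ f)
  (cong₂ _+_ (∑-map (g x) ys f) (∑-cartesianProductWith g xs ys f))

count-∑ : {P : Pred A 0ℓ} (P? : Decidable P) (xs : List A) → count P? xs ≡ ∑ xs (λ x → ⟦ P? x ⟧)
count-∑ P? []       = refl
count-∑ P? (x ∷ xs) with does (P? x)
... | true  = cong suc (count-∑ P? xs)
... | false = count-∑ P? xs

∑-upTo-suc : ∀ K (f : ℕ → ℕ) → ∑ (upTo (suc K)) f ≡ f 0 + ∑ (upTo K) (f ∘ suc)
∑-upTo-suc K f = cong sum (trans (map-upTo f (suc K)) (cong (f 0 ∷_) (sym (map-upTo (f ∘ suc) K))))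

-- Used mostly from right to left: it introduces a summation index for the value of a statistic, so
-- that sums can then be exchanged.
∑-pick : ∀ {i K} (f : ℕ → ℕ) → i <ℕ K → ∑ (upTo K) (λ j → f j * ⟦ i ≟ j ⟧) ≡ f i
∑-pick {zero} {suc K} f _ = begin
  ∑ (upTo (suc K)) (λ j → f j * ⟦ 0 ≟ j ⟧)         ≡⟨ ∑-upTo-suc K (λ j → f j * ⟦ 0 ≟ j ⟧) ⟩
  f 0 * 1 + ∑ (upTo K) (λ j → f (suc j) * 0)       ≡⟨ cong₂ _+_ (*-identityʳ (f 0)) (∑-zero (upTo K) λ j → *-zeroʳ (f (suc j))) ⟩
  f 0 + 0                                          ≡⟨ +-identityʳ (f 0) ⟩
  f 0                                              ∎
∑-pick {suc i} {suc K} f i<K = begin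
  ∑ (upTo (suc K)) (λ j → f j * ⟦ suc i ≟ j ⟧)           ≡⟨ ∑-upTo-suc K (λ j → f j * ⟦ suc i ≟ j ⟧) ⟩
  f 0 * 0 + ∑ (upTo K) (λ j → f (suc j) * ⟦ i ≟ j ⟧)     ≡⟨ cong₂ _+_ (*-zeroʳ (f 0)) (∑-pick (f ∘ suc) (s≤s⁻¹ i<K)) ⟩
  f (suc i)                                              ∎

-- `shift k f n` is f (n ∸ k) if k ≤ n, and 0 otherwise.
shift : ℕ → (ℕ → ℕ) → ℕ → ℕ
shift zero    f n       = f n
shift (suc k) f zero    = 0
shift (suc k) f (suc n) = shift k f n

shift-cong : ∀ k {f g : ℕ → ℕ} n → (∀ i → f i ≡ g i) → shift k f n ≡ shift k g n
shift-cong zero    n       eq = eq n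
shift-cong (suc k) zero    eq = refl
shift-cong (suc k) (suc n) eq = shift-cong k n eq

shift-*ˡ : ∀ k c f n → shift k (λ i → c * f i) n ≡ c * shift k f n
shift-*ˡ zero    c f n       = refl
shift-*ˡ (suc k) c f zero    = sym (*-zeroʳ c)
shift-*ˡ (suc k) c f (suc n) = shift-*ˡ k c f n

-- The only index that can contribute is `n ∸ k`, which lies below `K` because `n` does; for `n`
-- below `k` there is none.
∑-shift : ∀ k {n K} f → n <ℕ K → ∑ (upTo K) (λ i → f i * ⟦ n ≟ k + i ⟧) ≡ shift k f n
∑-shift zero            f n<K = ∑-pick f n<K
∑-shift (suc k) {zero}  {K} f n<K = ∑-zero (upTo K) λ i → *-zeroʳ (f i)
∑-shift (suc k) {suc n} f n<K = ∑-shift k f (<-trans (n<1+n n) n<K)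

-- Binomial coefficients

-- Pascal's rule persists across the boundary: at `suc n ≡ k` every term vanishes because the lower
-- index `suc b` is positive.
shift-pascal : ∀ k b n →
  shift k (_C suc b) (suc n) ≡ shift k (_C suc b) n + shift k (_C b) n
shift-pascal zero          b n       = trans (sym (nCk+nC[k+1]≡[n+1]C[k+1] n b)) (+-comm (n C b) _)
shift-pascal (suc zero)    b zero    = refl
shift-pascal (suc (suc k)) b zero    = refl
shift-pascal (suc k)       b (suc n) = shift-pascal k b n

pascal : ∀ n k → suc n C k ≡ shift 1 (n C_) k + n C k
pascal n zero    = refl
pascal n (suc k) = sym (nCk+nC[k+1]≡[n+1]C[k+1] n k)

-- Of two new elements, a subset takes both, neither, or one in two ways. The summands match the
-- codes 11, 00, 01, 10 of the steps other than (1,1).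
pascal² : ∀ n k →
  suc (suc n) C k ≡ shift 2 (n C_) k + (n C k + (shift 1 (n C_) k + shift 1 (n C_) k))
pascal² n zero = refl
pascal² n (suc k) = begin
  suc (suc n) C suc k                                 ≡⟨ pascal (suc n) (suc k) ⟩
  suc n C k + suc n C suc k                           ≡⟨ cong₂ _+_ (pascal n k) (pascal n (suc k)) ⟩
  shift 1 (n C_) k + n C k + (n C k + n C suc k)      ≡⟨ rearrange (shift 1 (n C_) k) (n C k) (n C suc k) ⟩
  shift 1 (n C_) k + (n C suc k + (n C k + n C k))    ∎
  where
  rearrange : ∀ a b c → a + b + (b + c) ≡ a + (c + (b + b))
  rearrange = solve-∀

-- Symmetry of the row 2r+1. It matches the coefficient for ties ending in T with the one for words
-- ending in H with Bob one ahead.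
central : ∀ r → (suc r + r) C r ≡ (r + suc r) C suc r
central r = begin
  (suc r + r) C r              ≡⟨ nCk≡nC[n∸k] (m≤n+m r (suc r)) ⟩
  (suc r + r) C (suc r + r ∸ r) ≡⟨ cong ((suc r + r) C_) (m+n∸n≡m (suc r) r) ⟩
  (suc r + r) C suc r          ≡⟨ cong (_C suc r) (sym (+-suc r r)) ⟩
  (r + suc r) C suc r          ∎

-- Pascal's rule splits the central coefficient into two neighbours, equal by symmetry. This is the
-- source of the 2 in N(n, n) = 1 + 2 R.
central-double : ∀ r → (suc r + suc r) C suc r ≡ 2 * ((suc r + r) C r)
central-double r = begin
  suc (r + suc r) C suc r                   ≡⟨ pascal (r + suc r) (suc r) ⟩
  (r + suc r) C r + (r + suc r) C suc r     ≡⟨ cong₂ _+_ (cong (_C r) (+-suc r r)) (sym (central r)) ⟩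
  (suc r + r) C r + (suc r + r) C r         ≡⟨ cong (_+_ ((suc r + r) C r)) (sym (+-identityʳ _)) ⟩
  2 * ((suc r + r) C r)                     ∎

-- Lattice paths

-- Steps other than (1,1), and the ones in their two-bit codes.
moves bits : Path S₀ → ℕ
moves []            = 0
moves ((i , _) ∷ p) = lookup (1 ∷ 1 ∷ 0 ∷ 1 ∷ []) i + moves p
bits  []            = 0
bits  ((i , _) ∷ p) = lookup (2 ∷ 0 ∷ 0 ∷ 1 ∷ []) i + bits p

moves≤length : ∀ p → moves p ≤ length p
moves≤length [] = z≤n
moves≤length ((zero              , _) ∷ p) = s≤s (moves≤length p)
moves≤length ((suc zero          , _) ∷ p) = s≤s (moves≤length p)
moves≤length ((suc (suc zero)    , _) ∷ p) = m≤n⇒m≤1+n (moves≤length p)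
moves≤length ((suc (suc (suc zero)) , _) ∷ p) = s≤s (moves≤length p)

-- Both sides are additive over steps, so four checks suffice: (6,5) contributes 7 to each side,
-- (3,3) contributes 4, and (0,1) and (1,1) contribute 1.
endpoint-x : ∀ p → proj₁ (endpoint S₀ p) + moves p ≡ length p + 3 * bits p
endpoint-x [] = refl
endpoint-x ((i , _) ∷ p) = extend i {proj₁ (endpoint S₀ p)} {moves p} {length p} {bits p} (endpoint-x p)
  where
  lhs : ∀ s t x m → s + x + (t + m) ≡ s + t + (x + m)
  lhs = solve-∀
  rhs₀ : ∀ l c → 7 + (l + 3 * c) ≡ suc l + 3 * (2 + c)
  rhs₀ = solve-∀
  rhs₃ : ∀ l c → 4 + (l + 3 * c) ≡ suc l + 3 * (1 + c)
  rhs₃ = solve-∀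
  extend : ∀ i {x m l c} → x + m ≡ l + 3 * c →
           proj₁ (lookup (ColoredSteps.step S₀) i) + x + (lookup (1 ∷ 1 ∷ 0 ∷ 1 ∷ []) i + m) ≡
           suc l + 3 * (lookup (2 ∷ 0 ∷ 0 ∷ 1 ∷ []) i + c)
  extend zero {x} {m} {l} {c} eq = trans (lhs 6 1 x m) (trans (cong (_+_ 7) eq) (rhs₀ l c))
  extend (suc zero) {x} {m} eq = trans (lhs 0 1 x m) (cong suc eq)
  extend (suc (suc zero)) {x} {m} eq = trans (lhs 1 0 x m) (cong suc eq)
  extend (suc (suc (suc zero))) {x} {m} {l} {c} eq =
    trans (lhs 3 1 x m) (trans (cong (_+_ 4) eq) (rhs₃ l c))

endpoint-y : ∀ p → proj₂ (endpoint S₀ p) ≡ length p + 2 * bits p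
endpoint-y [] = refl
endpoint-y ((i , _) ∷ p) = extend i {l = length p} {bits p} (endpoint-y p)
  where
  rhs₀ : ∀ l c → 5 + (l + 2 * c) ≡ suc l + 2 * (2 + c)
  rhs₀ = solve-∀
  rhs₃ : ∀ l c → 3 + (l + 2 * c) ≡ suc l + 2 * (1 + c)
  rhs₃ = solve-∀
  extend : ∀ i {y l c} → y ≡ l + 2 * c →
           proj₂ (lookup (ColoredSteps.step S₀) i) + y ≡
           suc l + 2 * (lookup (2 ∷ 0 ∷ 0 ∷ 1 ∷ []) i + c)
  extend zero {_} {l} {c} refl = rhs₀ l c
  extend (suc zero) refl = refl
  extend (suc (suc zero)) refl = refl
  extend (suc (suc (suc zero))) {_} {l} {c} refl = rhs₃ l c

-- By `endpoint-x` and `endpoint-y`, the coordinates differ by `bits p` minus `moves p`. On the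
-- diagonal these agree, and `endpoint-y` then fixes the length.
diagonal⇒ : ∀ p n → endpoint S₀ p ≡ (n , n) →
            bits p ≡ moves p × n ≡ moves p + moves p + length p
diagonal⇒ p n eq = bits≡moves , trans n≡ (trans (cong (λ c → length p + 2 * c) bits≡moves) (regroup (length p) (moves p)))
  where
  n≡ : n ≡ length p + 2 * bits p
  n≡ = trans (sym (cong proj₂ eq)) (endpoint-y p)
  regroup : ∀ l m → l + 2 * m ≡ m + m + l
  regroup = solve-∀
  split : ∀ l c → l + 3 * c ≡ l + 2 * c + c
  split = solve-∀
  bits≡moves : bits p ≡ moves p
  bits≡moves = sym (+-cancelˡ-≡ n (moves p) (bits p) (begin
    n + moves p                        ≡⟨ cong (_+ moves p) (sym (cong proj₁ eq)) ⟩
    proj₁ (endpoint S₀ p) + moves p    ≡⟨ endpoint-x p ⟩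
    length p + 3 * bits p              ≡⟨ split (length p) (bits p) ⟩
    length p + 2 * bits p + bits p     ≡⟨ cong (_+ bits p) (sym n≡) ⟩
    n + bits p                         ∎))

diagonal⇐ : ∀ p n → bits p ≡ moves p → n ≡ moves p + moves p + length p →
            endpoint S₀ p ≡ (n , n)
diagonal⇐ p n c≡m refl = cong₂ _,_
  (+-cancelʳ-≡ (moves p) _ n (trans (endpoint-x p)
    (trans (cong (λ c → length p + 3 * c) c≡m) (regroup³ (length p) (moves p)))))
  (trans (endpoint-y p) (trans (cong (λ c → length p + 2 * c) c≡m) (regroup² (length p) (moves p))))
  where
  regroup³ : ∀ l m → l + 3 * m ≡ m + m + l + m
  regroup³ = solve-∀
  regroup² : ∀ l m → l + 2 * m ≡ m + m + l
  regroup² = solve-∀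

diagonal-indicator : ∀ p n → ⟦ endpoint S₀ p ≟² (n , n) ⟧ ≡
                     ⟦ n ≟ moves p + moves p + length p ⟧ * ⟦ moves p ≟ bits p ⟧
diagonal-indicator p n = ⟦⟧-×
  (endpoint S₀ p ≟² (n , n)) (n ≟ moves p + moves p + length p) (moves p ≟ bits p)
  (λ eq → proj₂ (diagonal⇒ p n eq) , sym (proj₁ (diagonal⇒ p n eq)))
  (λ n≡ m≡ → diagonal⇐ p n (sym m≡) n≡)

#paths : ℕ → ℕ → ℕ → ℕ
#paths L m c = ∑ (pathsOfLength S₀ L) λ p → ⟦ m ≟ moves p ⟧ * ⟦ c ≟ bits p ⟧

#paths-shift : ∀ L m k c →
  ∑ (pathsOfLength S₀ L) (λ p → ⟦ m ≟ moves p ⟧ * ⟦ c ≟ k + bits p ⟧) ≡ shift k (#paths L m) c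
#paths-shift L m zero    c       = refl
#paths-shift L m (suc k) zero    = ∑-zero (pathsOfLength S₀ L) λ p → *-zeroʳ ⟦ m ≟ moves p ⟧
#paths-shift L m (suc k) (suc c) = #paths-shift L m k c

-- Choose which m of the L steps differ from (1,1), then which c of their 2m code bits are ones. The
-- induction removes the first step.
#paths-formula : ∀ L m c → #paths L m c ≡ (L C m) * ((m + m) C c)
#paths-formula zero zero    zero    = refl
#paths-formula zero zero    (suc c) = refl
#paths-formula zero (suc m) c       = refl
#paths-formula (suc L) zero c = begin
  #paths (suc L) 0 c                             ≡⟨ ∑-cartesianProductWith _∷_ (coloredSteps S₀) ps _ ⟩
  ∑ ps (λ _ → 0) + (∑ ps (λ _ → 0) + (#paths L 0 c + (∑ ps (λ _ → 0) + (∑ ps (λ _ → 0) + 0))))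
    ≡⟨ cong (λ z → z + (z + (#paths L 0 c + (z + (z + 0))))) (∑-zero ps λ _ → refl) ⟩
  #paths L 0 c + 0                               ≡⟨ +-identityʳ _ ⟩
  #paths L 0 c                                   ≡⟨ #paths-formula L 0 c ⟩
  (L C 0) * (0 C c)                                ∎
  where ps = pathsOfLength S₀ L
#paths-formula (suc L) (suc m) c = begin
  #paths (suc L) (suc m) c
    ≡⟨ ∑-cartesianProductWith _∷_ (coloredSteps S₀) (pathsOfLength S₀ L) _ ⟩
  -- The summands are the possible first steps (6,5), (0,1), (1,1) and the two colours of (3,3).
  -- Only (1,1) leaves the number of moves at `suc m`.
  extend 2 + (extend 0 + (#paths L (suc m) c + (extend 1 + (extend 1 + 0))))
    ≡⟨ cong₂ _+_ (extend≡ 2) (cong₂ _+_ (extend≡ 0) (cong₂ _+_ (#paths-formula L (suc m) c)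
         (cong₂ _+_ (extend≡ 1) (cong (_+ 0) (extend≡ 1))))) ⟩
  a * s 2 + (a * s 0 + (b * w + (a * s 1 + (a * s 1 + 0))))
    ≡⟨ collect a b w (s 2) (s 0) (s 1) ⟩
  a * (s 2 + (s 0 + (s 1 + s 1))) + b * w
    ≡⟨ cong (λ v → a * v + b * w) (sym (trans (cong (λ k → suc k C c) (+-suc m m)) (pascal² (m + m) c))) ⟩
  a * w + b * w
    ≡⟨ sym (*-distribʳ-+ w a b) ⟩
  (a + b) * w
    ≡⟨ cong (_* w) (nCk+nC[k+1]≡[n+1]C[k+1] L m) ⟩
  (suc L C suc m) * w ∎
  where
  a = L C m
  b = L C suc m
  w = (suc m + suc m) C c
  s : ℕ → ℕ
  s k = shift k ((m + m) C_) c
  extend : ℕ → ℕ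
  extend k = ∑ (pathsOfLength S₀ L) (λ p → ⟦ m ≟ moves p ⟧ * ⟦ c ≟ k + bits p ⟧)
  extend≡ : ∀ k → extend k ≡ a * s k
  extend≡ k = trans (#paths-shift L m k c)
    (trans (shift-cong k c (#paths-formula L m)) (shift-*ˡ k a ((m + m) C_) c))
  collect : ∀ a b w x y z →
            a * x + (a * y + (b * w + (a * z + (a * z + 0)))) ≡ a * (x + (y + (z + z))) + b * w
  collect = solve-∀

-- Paths are sorted by their common value m of `moves` and `bits`. It is at most the length L, hence
-- within the range of summation.
#diagonal-paths : ∀ n {L K} → L <ℕ K →
  ∑ (pathsOfLength S₀ L) (λ p → ⟦ endpoint S₀ p ≟² (n , n) ⟧) ≡
  ∑ (upTo K) (λ m → ((m + m) C m) * ((L C m) * ⟦ n ≟ m + m + L ⟧))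
#diagonal-paths n {L} {K} L<K = begin
  ∑ ps (λ p → ⟦ endpoint S₀ p ≟² (n , n) ⟧)
    ≡⟨ ∑-cong-∈ ps expand ⟩
  ∑ ps (λ p → ∑ (upTo K) (λ m → d m * (⟦ m ≟ moves p ⟧ * ⟦ m ≟ bits p ⟧)))
    ≡⟨ ∑-swap ps (upTo K) _ ⟩
  ∑ (upTo K) (λ m → ∑ ps (λ p → d m * (⟦ m ≟ moves p ⟧ * ⟦ m ≟ bits p ⟧)))
    ≡⟨ ∑-cong (upTo K) (λ m → trans (∑-*ˡ ps (d m) _)
         (trans (cong (d m *_) (#paths-formula L m m)) (rotate (d m) (L C m) ((m + m) C m)))) ⟩
  ∑ (upTo K) (λ m → ((m + m) C m) * ((L C m) * d m)) ∎
  where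
  ps = pathsOfLength S₀ L
  d : ℕ → ℕ
  d m = ⟦ n ≟ m + m + L ⟧
  rotate : ∀ x y z → x * (y * z) ≡ z * (y * x)
  rotate = solve-∀
  expand : ∀ {p} → p ∈ ps → ⟦ endpoint S₀ p ≟² (n , n) ⟧ ≡
           ∑ (upTo K) (λ m → d m * (⟦ m ≟ moves p ⟧ * ⟦ m ≟ bits p ⟧))
  expand {p} p∈ = begin
    ⟦ endpoint S₀ p ≟² (n , n) ⟧
      ≡⟨ diagonal-indicator p n ⟩
    ⟦ n ≟ moves p + moves p + length p ⟧ * ⟦ moves p ≟ bits p ⟧
      ≡⟨ cong (λ l → ⟦ n ≟ moves p + moves p + l ⟧ * ⟦ moves p ≟ bits p ⟧) length≡L ⟩
    d (moves p) * ⟦ moves p ≟ bits p ⟧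
      ≡⟨ ∑-pick (λ m → d m * ⟦ m ≟ bits p ⟧) (≤-<-trans (moves≤length p) (subst (_<ℕ K) (sym length≡L) L<K)) ⟨
    ∑ (upTo K) (λ m → d m * ⟦ m ≟ bits p ⟧ * ⟦ moves p ≟ m ⟧)
      ≡⟨ ∑-cong (upTo K) (λ m → trans (cong (d m * ⟦ m ≟ bits p ⟧ *_) (⟦≟⟧-sym (moves p) m))
           (reorder (d m) ⟦ m ≟ bits p ⟧ ⟦ m ≟ moves p ⟧)) ⟩
    ∑ (upTo K) (λ m → d m * (⟦ m ≟ moves p ⟧ * ⟦ m ≟ bits p ⟧)) ∎
    where
    length≡L : length p ≡ L
    length≡L = pathsOfLength⇒length S₀ {L} p∈
    reorder : ∀ x y z → x * y * z ≡ x * (z * y)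
    reorder = solve-∀

-- For each m only the length L = n - 2m contributes, which collapses the sum over lengths to
-- `shift`.
N-diagonal : ∀ n → N S₀ n n ≡
             ∑ (upTo (suc (n + n))) (λ m → ((m + m) C m) * shift (m + m) (_C m) n)
N-diagonal n = begin
  N S₀ n n
    ≡⟨ count-∑ (λ p → endpoint S₀ p ≟² (n , n)) (concatMap (pathsOfLength S₀) (upTo K)) ⟩
  ∑ (concatMap (pathsOfLength S₀) (upTo K)) (λ p → ⟦ endpoint S₀ p ≟² (n , n) ⟧)
    ≡⟨ ∑-concatMap (pathsOfLength S₀) (upTo K) _ ⟩
  ∑ (upTo K) (λ L → ∑ (pathsOfLength S₀ L) (λ p → ⟦ endpoint S₀ p ≟² (n , n) ⟧))
    ≡⟨ ∑-cong-∈ (upTo K) (λ L∈ → #diagonal-paths n (∈-upTo⁻ L∈)) ⟩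
  ∑ (upTo K) (λ L → ∑ (upTo K) (λ m → ((m + m) C m) * ((L C m) * ⟦ n ≟ m + m + L ⟧)))
    ≡⟨ ∑-swap (upTo K) (upTo K) _ ⟩
  ∑ (upTo K) (λ m → ∑ (upTo K) (λ L → ((m + m) C m) * ((L C m) * ⟦ n ≟ m + m + L ⟧)))
    ≡⟨ ∑-cong (upTo K) (λ m → trans (∑-*ˡ (upTo K) ((m + m) C m) _)
         (cong (((m + m) C m) *_) (∑-shift (m + m) (_C m) (s≤s (m≤m+n n n))))) ⟩
  ∑ (upTo K) (λ m → ((m + m) C m) * shift (m + m) (_C m) n) ∎
  where K = suc (n + n)

-- Coin flips

-- A weight of the last coin and of Alice's and Bob's scores.
Weight : Set
Weight = Coin → ℕ → ℕ → ℕ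

-- The transfer operator of one flip: it sums the weight over both successors of the state with last
-- coin `q` and scores `a`, `b`. Only flips after H score.
flip : Weight → Weight
flip φ T a b = φ H a b + φ T a b
flip φ H a b = φ H (suc a) b + φ T a (suc b)

total : ℕ → Weight → Weight
total zero    φ = φ
total (suc n) φ = flip (total n φ)

-- Peels off the last flip, whereas the definition of `total` peels off the first.
total-suc : ∀ n φ → total (suc n) φ ≡ total n (flip φ)
total-suc zero    φ = refl
total-suc (suc n) φ = cong flip (total-suc n φ)

-- Bob gains at most one point per flip. The bound allows weights to be expanded into finite sums of
-- `at`, which is valid only for bounded scores.
total-cong-≤ : ∀ n φ ψ q a b → (∀ q′ a′ b′ → b′ ≤ b + n → φ q′ a′ b′ ≡ ψ q′ a′ b′) →
               total n φ q a b ≡ total n ψ q a b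
total-cong-≤ zero    φ ψ q a b eq = eq q a b (m≤m+n b 0)
total-cong-≤ (suc n) φ ψ T a b eq = cong₂ _+_
  (total-cong-≤ n φ ψ H a b λ q′ a′ b′ le → eq q′ a′ b′ (≤-trans le (+-monoʳ-≤ b (n≤1+n n))))
  (total-cong-≤ n φ ψ T a b λ q′ a′ b′ le → eq q′ a′ b′ (≤-trans le (+-monoʳ-≤ b (n≤1+n n))))
total-cong-≤ (suc n) φ ψ H a b eq = cong₂ _+_
  (total-cong-≤ n φ ψ H (suc a) b λ q′ a′ b′ le → eq q′ a′ b′ (≤-trans le (+-monoʳ-≤ b (n≤1+n n))))
  (total-cong-≤ n φ ψ T a (suc b) λ q′ a′ b′ le → eq q′ a′ b′ (≤-trans le (≤-reflexive (sym (+-suc b n)))))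

total-cong : ∀ n φ ψ → (∀ q a b → φ q a b ≡ ψ q a b) → ∀ q a b → total n φ q a b ≡ total n ψ q a b
total-cong n φ ψ eq q a b = total-cong-≤ n φ ψ q a b λ q′ a′ b′ _ → eq q′ a′ b′

total-flip : ∀ n φ ψ → (∀ q a b → flip φ q a b ≡ ψ q a b) →
             ∀ q a b → total (suc n) φ q a b ≡ total n ψ q a b
total-flip n φ ψ eq q a b =
  trans (cong (λ f → f q a b) (total-suc n φ)) (total-cong n (flip φ) ψ eq q a b)

infixl 6 _⊕_
_⊕_ : Weight → Weight → Weight
(φ ⊕ ψ) q a b = φ q a b + ψ q a b

total-⊕ : ∀ n φ ψ q a b → total n (φ ⊕ ψ) q a b ≡ total n φ q a b + total n ψ q a b
total-⊕ zero    φ ψ q a b = refl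
total-⊕ (suc n) φ ψ T a b =
  trans (cong₂ _+_ (total-⊕ n φ ψ H a b) (total-⊕ n φ ψ T a b)) (+-interchange (total n φ H a b) _ _ _)
total-⊕ (suc n) φ ψ H a b =
  trans (cong₂ _+_ (total-⊕ n φ ψ H (suc a) b) (total-⊕ n φ ψ T a (suc b))) (+-interchange (total n φ H (suc a) b) _ _ _)

total-∑ : ∀ n (xs : List A) (φ : A → Weight) q a b →
          total n (λ q a b → ∑ xs (λ i → φ i q a b)) q a b ≡ ∑ xs (λ i → total n (φ i) q a b)
total-∑ zero    xs φ q a b = refl
total-∑ (suc n) xs φ T a b =
  trans (cong₂ _+_ (total-∑ n xs φ H a b) (total-∑ n xs φ T a b)) (sym (∑-+ xs _ _))
total-∑ (suc n) xs φ H a b =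
  trans (cong₂ _+_ (total-∑ n xs φ H (suc a) b) (total-∑ n xs φ T a (suc b))) (sym (∑-+ xs _ _))

occurrences-∷ : ∀ p c d {n} (x : Vec Coin n) →
  occurrences p (c ∷ d ∷ x) ≡ ⟦ (c , d) ≟ᶜᶜ p ⟧ + occurrences p (d ∷ x)
occurrences-∷ p c d {n} x = begin
  occurrences p (c ∷ d ∷ x)                    ≡⟨ count-∑ (at? (c ∷ d ∷ x)) (allFin (suc n)) ⟩
  h zero + ∑ (tabulate suc) h                  ≡⟨ cong (λ l → h zero + sum l) (map-tabulate suc h) ⟩
  h zero + sum (tabulate (h ∘ suc))            ≡⟨ cong (λ l → h zero + sum l) (sym (map-tabulate id (h ∘ suc))) ⟩
  h zero + ∑ (allFin n) (h ∘ suc)              ≡⟨ cong (_+_ (h zero)) (sym (count-∑ (at? (d ∷ x)) (allFin n))) ⟩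
  h zero + occurrences p (d ∷ x)               ∎
  where
  at? : ∀ {m} (y : Vec Coin (suc m)) → Decidable (λ i → (lookup y (inject₁ i) , lookup y (suc i)) ≡ p)
  at? y i = (lookup y (inject₁ i) , lookup y (suc i)) ≟ᶜᶜ p
  h : Fin (suc n) → ℕ
  h i = ⟦ at? (c ∷ d ∷ x) i ⟧

-- Induction on the first flip: the point scored by `q` and that flip moves between the word and the
-- accumulated scores `a`, `b`.
total-flips : ∀ n (f : ℕ → ℕ → ℕ) q a b → total n (λ _ → f) q a b ≡
              ∑ (flips n) (λ x → f (a + alice (q ∷ x)) (b + bob (q ∷ x)))
total-flips zero f q a b =
  sym (trans (+-identityʳ _) (cong₂ f (+-identityʳ a) (+-identityʳ b)))
total-flips (suc n) f q a b = begin
  total (suc n) (λ _ → f) q a b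
    ≡⟨ first q ⟩
  ∑ (flips n) (λ x → g (H ∷ x)) + (∑ (flips n) (λ x → g (T ∷ x)) + 0)
    ≡⟨ ∑-cartesianProductWith _∷_ (H ∷ T ∷ []) (flips n) g ⟨
  ∑ (flips (suc n)) g ∎
  where
  g : Vec Coin (suc n) → ℕ
  g x = f (a + alice (q ∷ x)) (b + bob (q ∷ x))
  next : ∀ c d a′ b′ → (∀ (x : Vec Coin n) → a′ + alice (d ∷ x) ≡ a + alice (c ∷ d ∷ x)) →
         (∀ (x : Vec Coin n) → b′ + bob (d ∷ x) ≡ b + bob (c ∷ d ∷ x)) →
         total n (λ _ → f) d a′ b′ ≡
         ∑ (flips n) (λ x → f (a + alice (c ∷ d ∷ x)) (b + bob (c ∷ d ∷ x)))
  next c d a′ b′ eqᵃ eqᵇ =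
    trans (total-flips n f d a′ b′) (∑-cong (flips n) λ x → cong₂ f (eqᵃ x) (eqᵇ x))
  same : ∀ p c d k → ⟦ (c , d) ≟ᶜᶜ p ⟧ ≡ 0 → (x : Vec Coin n) →
         k + occurrences p (d ∷ x) ≡ k + occurrences p (c ∷ d ∷ x)
  same p c d k eq x = cong (_+_ k) (sym (trans (occurrences-∷ p c d x) (cong (_+ occurrences p (d ∷ x)) eq)))
  more : ∀ p c d k → ⟦ (c , d) ≟ᶜᶜ p ⟧ ≡ 1 → (x : Vec Coin n) →
         suc k + occurrences p (d ∷ x) ≡ k + occurrences p (c ∷ d ∷ x)
  more p c d k eq x = trans (sym (+-suc k _))
    (cong (_+_ k) (sym (trans (occurrences-∷ p c d x) (cong (_+ occurrences p (d ∷ x)) eq))))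
  first : ∀ q → total (suc n) (λ _ → f) q a b ≡
          ∑ (flips n) (λ x → f (a + alice (q ∷ H ∷ x)) (b + bob (q ∷ H ∷ x))) +
          (∑ (flips n) (λ x → f (a + alice (q ∷ T ∷ x)) (b + bob (q ∷ T ∷ x))) + 0)
  first T = cong₂ _+_
    (next T H a b (same (H , H) T H a refl) (same (H , T) T H b refl))
    (trans (next T T a b (same (H , H) T T a refl) (same (H , T) T T b refl)) (sym (+-identityʳ _)))
  first H = cong₂ _+_
    (next H H (suc a) b (more (H , H) H H a refl) (same (H , T) H H b refl))
    (trans (next H T a (suc b) (same (H , H) H T a refl) (more (H , T) H T b refl)) (sym (+-identityʳ _)))

-- Both scored pairs begin with H, so a fictitious T before the first flip is harmless. Hence all
-- counts start in the state `T 0 0`.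
occurrences-H-T∷ : ∀ c {n} (x : Vec Coin n) → occurrences (H , c) (T ∷ x) ≡ occurrences (H , c) x
occurrences-H-T∷ c []      = refl
occurrences-H-T∷ c (d ∷ x) = occurrences-∷ (H , c) T d x

count-flips : ∀ n {P : ℕ → ℕ → Set} (P? : ∀ a b → Dec (P a b)) →
  count (λ x → P? (alice x) (bob x)) (flips n) ≡ total n (λ _ a b → ⟦ P? a b ⟧) T 0 0
count-flips n P? = begin
  count (λ x → P? (alice x) (bob x)) (flips n)
    ≡⟨ count-∑ (λ x → P? (alice x) (bob x)) (flips n) ⟩
  ∑ (flips n) (λ x → ⟦ P? (alice x) (bob x) ⟧)
    ≡⟨ ∑-cong (flips n) (λ x → cong₂ (λ a b → ⟦ P? a b ⟧) (occurrences-H-T∷ H x) (occurrences-H-T∷ T x)) ⟨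
  ∑ (flips n) (λ x → ⟦ P? (alice (T ∷ x)) (bob (T ∷ x)) ⟧)
    ≡⟨ total-flips n (λ a b → ⟦ P? a b ⟧) T 0 0 ⟨
  total n (λ _ a b → ⟦ P? a b ⟧) T 0 0 ∎

-- Words with given last coin and scores

at : Coin → ℕ → ℕ → Weight
at H a b H a′ b′ = ⟦ a′ ≟ a ⟧ * ⟦ b′ ≟ b ⟧
at T a b T a′ b′ = ⟦ a′ ≟ a ⟧ * ⟦ b′ ≟ b ⟧
at _ a b _ a′ b′ = 0

-- This and the next three identities trace the last flip back: a final T after H gives Bob a point,
-- a final H after H gives Alice one, and a flip after T gives none. A score of 0 rules out the
-- predecessor that would have scored.
flip-at-T-zero : ∀ a q a′ b′ → flip (at T a 0) q a′ b′ ≡ at T a 0 q a′ b′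
flip-at-T-zero a T a′ b′ = refl
flip-at-T-zero a H a′ b′ = *-zeroʳ ⟦ a′ ≟ a ⟧

flip-at-T-suc : ∀ a b q a′ b′ → flip (at T a (suc b)) q a′ b′ ≡ (at T a (suc b) ⊕ at H a b) q a′ b′
flip-at-T-suc a b T a′ b′ = sym (+-identityʳ _)
flip-at-T-suc a b H a′ b′ = refl

flip-at-H-zero : ∀ b q a′ b′ → flip (at H 0 b) q a′ b′ ≡ at T 0 b q a′ b′
flip-at-H-zero b T a′ b′ = +-identityʳ _
flip-at-H-zero b H a′ b′ = refl

flip-at-H-suc : ∀ a b q a′ b′ → flip (at H (suc a) b) q a′ b′ ≡ (at T (suc a) b ⊕ at H a b) q a′ b′
flip-at-H-suc a b T a′ b′ = refl
flip-at-H-suc a b H a′ b′ = +-identityʳ _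

-- The number of compositions of a + b into b parts.
compositions : ℕ → ℕ → ℕ
compositions a zero    = ⟦ 0 ≟ a ⟧
compositions a (suc b) = (a + b) C b

compositions-zero : ∀ b → compositions 0 b ≡ b C b
compositions-zero zero    = refl
compositions-zero (suc b) = trans (nCn≡1 b) (sym (nCn≡1 (suc b)))

-- Compositions of a + b + 2 into b + 1 parts, sorted by whether the last part is 1 or can be
-- reduced by one.
compositions-suc : ∀ a b → compositions (suc a) b + (a + b) C b ≡ suc (a + b) C b
compositions-suc a zero    = refl
compositions-suc a (suc b) = trans (cong (λ k → k C b + (a + suc b) C suc b) (sym (+-suc a b)))
  (nCk+nC[k+1]≡[n+1]C[k+1] (a + suc b) b)

-- A word with t tails and scores a, b that ends in T (respectively H) has a + b
-- (respectively a + b + 1) heads, forming b (respectively b + 1) runs, b of which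
-- are placed in front of b of the t tails.
#ending-T : ∀ n a b → total n (at T a b) T 0 0 ≡ compositions a b * shift (a + b) (_C b) n
#ending-H : ∀ n a b → total n (at H a b) T 0 0 ≡ ((a + b) C b) * shift (suc (a + b)) (_C b) n

#ending-T zero zero    zero    = refl
#ending-T zero zero    (suc b) = sym (*-zeroʳ (compositions 0 (suc b)))
#ending-T zero (suc a) b       = sym (*-zeroʳ (compositions (suc a) b))
#ending-T (suc n) a zero = begin
  total (suc n) (at T a 0) T 0 0                 ≡⟨ total-flip n _ _ (flip-at-T-zero a) T 0 0 ⟩
  total n (at T a 0) T 0 0                       ≡⟨ #ending-T n a 0 ⟩
  compositions a 0 * shift (a + 0) (_C 0) n      ≡⟨ constant a ⟩
  compositions a 0 * shift (a + 0) (_C 0) (suc n) ∎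
  where
  -- For positive `a` both sides are 0. For `a` zero both are 1, counting the word T...T.
  constant : ∀ a → compositions a 0 * shift (a + 0) (_C 0) n ≡ compositions a 0 * shift (a + 0) (_C 0) (suc n)
  constant zero    = refl
  constant (suc a) = refl
#ending-T (suc n) a (suc b) rewrite +-suc a b = begin
  total (suc n) (at T a (suc b)) T 0 0
    ≡⟨ total-flip n _ _ (flip-at-T-suc a b) T 0 0 ⟩
  total n (at T a (suc b) ⊕ at H a b) T 0 0
    ≡⟨ total-⊕ n (at T a (suc b)) (at H a b) T 0 0 ⟩
  total n (at T a (suc b)) T 0 0 + total n (at H a b) T 0 0
    ≡⟨ cong₂ _+_ (trans (#ending-T n a (suc b)) (cong (λ k → w * shift k (_C suc b) n) (+-suc a b))) (#ending-H n a b) ⟩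
  w * shift (suc (a + b)) (_C suc b) n + w * shift (suc (a + b)) (_C b) n
    ≡⟨ *-distribˡ-+ w _ _ ⟨
  w * (shift (suc (a + b)) (_C suc b) n + shift (suc (a + b)) (_C b) n)
    ≡⟨ cong (w *_) (shift-pascal (suc (a + b)) b n) ⟨
  w * shift (suc (a + b)) (_C suc b) (suc n) ∎
  where w = (a + b) C b

#ending-H zero a b = sym (*-zeroʳ ((a + b) C b))
#ending-H (suc n) zero b = begin
  total (suc n) (at H 0 b) T 0 0        ≡⟨ total-flip n _ _ (flip-at-H-zero b) T 0 0 ⟩
  total n (at T 0 b) T 0 0              ≡⟨ #ending-T n 0 b ⟩
  compositions 0 b * shift b (_C b) n   ≡⟨ cong (_* shift b (_C b) n) (compositions-zero b) ⟩
  (b C b) * shift b (_C b) n            ∎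
#ending-H (suc n) (suc a) b = begin
  total (suc n) (at H (suc a) b) T 0 0
    ≡⟨ total-flip n _ _ (flip-at-H-suc a b) T 0 0 ⟩
  total n (at T (suc a) b ⊕ at H a b) T 0 0
    ≡⟨ total-⊕ n (at T (suc a) b) (at H a b) T 0 0 ⟩
  total n (at T (suc a) b) T 0 0 + total n (at H a b) T 0 0
    ≡⟨ cong₂ _+_ (#ending-T n (suc a) b) (#ending-H n a b) ⟩
  compositions (suc a) b * w + ((a + b) C b) * w
    ≡⟨ *-distribʳ-+ w (compositions (suc a) b) _ ⟨
  (compositions (suc a) b + (a + b) C b) * w
    ≡⟨ cong (_* w) (compositions-suc a b) ⟩
  (suc (a + b) C b) * w ∎
  where w = shift (suc (a + b)) (_C b) n

-- Comparison of the wins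

bobWins aliceWins tie-T lead-H trail-H : Weight
bobWins   _ a b = ⟦ a <? b ⟧
aliceWins _ a b = ⟦ b <? a ⟧
tie-T   T a b = ⟦ a ≟ b ⟧
tie-T   H a b = 0
lead-H  T a b = 0
lead-H  H a b = ⟦ b ≟ suc a ⟧
trail-H T a b = 0
trail-H H a b = ⟦ a ≟ suc b ⟧

-- A tie ending in T arises by appending T either to a tie ending in T or to a word ending in H with
-- Bob one behind.
flip-tie-T : ∀ q a b → flip tie-T q a b ≡ (tie-T ⊕ trail-H) q a b
flip-tie-T T a b = sym (+-identityʳ _)
flip-tie-T H a b = refl

-- A flip after T leaves the scores unchanged; after H it moves the difference of the
-- scores by ±1, and then the mean of its sign changes only next to a tie.
flip-wins : ∀ q a b → (flip bobWins ⊕ (aliceWins ⊕ aliceWins ⊕ lead-H)) q a b ≡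
                      (flip aliceWins ⊕ (bobWins ⊕ bobWins ⊕ trail-H)) q a b
flip-wins T a b = swap ⟦ a <? b ⟧ ⟦ b <? a ⟧
  where
  swap : ∀ x y → x + x + (y + y + 0) ≡ y + y + (x + x + 0)
  swap = solve-∀
-- Every term depends only on the difference of the scores, so one of them may be reduced to 0.
flip-wins H zero    zero          = refl
flip-wins H zero    (suc zero)    = refl
flip-wins H zero    (suc (suc b)) = refl
flip-wins H (suc zero)    zero    = refl
flip-wins H (suc (suc a)) zero    = refl
flip-wins H (suc a) (suc b)       = flip-wins H a b

-- The number R, with term `r` for common score r + 1. Terms with 2(r + 1) > n vanish; the range is
-- that of `N-diagonal` without m = 0.
nontrivialTies : ℕ → ℕ
nontrivialTies n =
  ∑ (upTo (n + n)) λ r → ((suc r + r) C r) * shift (suc r + suc r) (_C suc r) n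

tie-T-expand : ∀ K q a b → b ≤ K →
  tie-T q a b ≡ (at T 0 0 ⊕ λ q a b → ∑ (upTo K) λ r → at T (suc r) (suc r) q a b) q a b
tie-T-expand K H a b b≤K = sym (∑-zero (upTo K) λ _ → refl)
tie-T-expand K T a b b≤K =
  trans (sym (∑-pick (λ r → ⟦ a ≟ r ⟧) (s≤s b≤K))) (∑-upTo-suc K (λ r → ⟦ a ≟ r ⟧ * ⟦ b ≟ r ⟧))

lead-H-expand : ∀ K q a b → b ≤ K → lead-H q a b ≡ ∑ (upTo K) λ r → at H r (suc r) q a b
lead-H-expand K T a b       b≤K = sym (∑-zero (upTo K) λ _ → refl)
lead-H-expand K H a zero    b≤K = sym (∑-zero (upTo K) λ r → *-zeroʳ ⟦ a ≟ r ⟧)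
lead-H-expand K H a (suc b) b≤K = trans (⟦≟⟧-sym b a) (sym (∑-pick (λ r → ⟦ a ≟ r ⟧) b≤K))

-- The extra one is T...T, the only word ending in T with both scores 0.
#tie-T : ∀ n → total n tie-T T 0 0 ≡ suc (nontrivialTies n)
#tie-T n = begin
  total n tie-T T 0 0
    ≡⟨ total-cong-≤ n tie-T (at T 0 0 ⊕ ties) T 0 0
         (λ q a b b≤n → tie-T-expand (n + n) q a b (≤-trans b≤n (m≤m+n n n))) ⟩
  total n (at T 0 0 ⊕ ties) T 0 0
    ≡⟨ total-⊕ n (at T 0 0) ties T 0 0 ⟩
  total n (at T 0 0) T 0 0 + total n ties T 0 0
    ≡⟨ cong₂ _+_ (#ending-T n 0 0) (trans (total-∑ n (upTo (n + n)) (λ r → at T (suc r) (suc r)) T 0 0)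
         (∑-cong (upTo (n + n)) λ r → #ending-T n (suc r) (suc r))) ⟩
  suc (nontrivialTies n) ∎
  where
  ties : Weight
  ties q a b = ∑ (upTo (n + n)) λ r → at T (suc r) (suc r) q a b

#lead-H : ∀ n → total n lead-H T 0 0 ≡ nontrivialTies n
#lead-H n = begin
  total n lead-H T 0 0
    ≡⟨ total-cong-≤ n lead-H leads T 0 0
         (λ q a b b≤n → lead-H-expand (n + n) q a b (≤-trans b≤n (m≤m+n n n))) ⟩
  total n leads T 0 0
    ≡⟨ total-∑ n (upTo (n + n)) (λ r → at H r (suc r)) T 0 0 ⟩
  ∑ (upTo (n + n)) (λ r → total n (at H r (suc r)) T 0 0)
    ≡⟨ ∑-cong (upTo (n + n)) (λ r → trans (#ending-H n r (suc r))
         (cong (_* shift (suc r + suc r) (_C suc r) n) (sym (central r)))) ⟩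
  nontrivialTies n ∎
  where
  leads : Weight
  leads q a b = ∑ (upTo (n + n)) λ r → at H r (suc r) q a b

-- Let A, B count the wins at length n and A', B' those at n + 1, and let s count the words ending
-- in H with Bob one behind. Then `flip-wins` gives B' + 2A + R = A' + 2B + s, so B = A + R yields
-- B' = A' + R + s, and `ties-suc` identifies R + s as the next R.
#bobWins : ∀ n → total n bobWins T 0 0 ≡ total n aliceWins T 0 0 + nontrivialTies n
#bobWins zero    = refl
#bobWins (suc n) = trans b′≡ (cong (_+_ a′) (suc-injective (sym ties-suc)))
  where
  ⟨_⟩ : Weight → ℕ
  ⟨ φ ⟩ = total n φ T 0 0
  a′ b′ a b s R : ℕ
  a′ = total (suc n) aliceWins T 0 0
  b′ = total (suc n) bobWins T 0 0
  a  = ⟨ aliceWins ⟩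
  b  = ⟨ bobWins ⟩
  s  = ⟨ trail-H ⟩
  R  = nontrivialTies n

  ties-suc : suc (nontrivialTies (suc n)) ≡ suc (R + s)
  ties-suc = begin
    suc (nontrivialTies (suc n))      ≡⟨ #tie-T (suc n) ⟨
    total (suc n) tie-T T 0 0         ≡⟨ total-flip n tie-T (tie-T ⊕ trail-H) flip-tie-T T 0 0 ⟩
    ⟨ tie-T ⊕ trail-H ⟩               ≡⟨ total-⊕ n tie-T trail-H T 0 0 ⟩
    ⟨ tie-T ⟩ + s                     ≡⟨ cong (_+ s) (#tie-T n) ⟩
    suc (R + s)                       ∎

  expand : ∀ φ ψ χ → ⟨ flip φ ⊕ (ψ ⊕ ψ ⊕ χ) ⟩ ≡ total (suc n) φ T 0 0 + (⟨ ψ ⟩ + ⟨ ψ ⟩ + ⟨ χ ⟩)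
  expand φ ψ χ = begin
    ⟨ flip φ ⊕ (ψ ⊕ ψ ⊕ χ) ⟩                            ≡⟨ total-⊕ n (flip φ) (ψ ⊕ ψ ⊕ χ) T 0 0 ⟩
    ⟨ flip φ ⟩ + ⟨ ψ ⊕ ψ ⊕ χ ⟩                          ≡⟨ cong₂ _+_ (cong (λ f → f T 0 0) (sym (total-suc n φ)))
                                                            (trans (total-⊕ n (ψ ⊕ ψ) χ T 0 0) (cong (_+ ⟨ χ ⟩) (total-⊕ n ψ ψ T 0 0))) ⟩
    total (suc n) φ T 0 0 + (⟨ ψ ⟩ + ⟨ ψ ⟩ + ⟨ χ ⟩)     ∎

  regroup : ∀ a′ a R s → a′ + (a + R + (a + R) + s) ≡ a′ + (R + s) + (a + a + R)
  regroup = solve-∀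

  b′≡ : b′ ≡ a′ + (R + s)
  b′≡ = +-cancelʳ-≡ (a + a + R) b′ (a′ + (R + s)) (begin
    b′ + (a + a + R)                                    ≡⟨ cong (λ h → b′ + (a + a + h)) (#lead-H n) ⟨
    b′ + (a + a + ⟨ lead-H ⟩)                           ≡⟨ expand bobWins aliceWins lead-H ⟨
    ⟨ flip bobWins ⊕ (aliceWins ⊕ aliceWins ⊕ lead-H) ⟩ ≡⟨ total-cong n _ _ flip-wins T 0 0 ⟩
    ⟨ flip aliceWins ⊕ (bobWins ⊕ bobWins ⊕ trail-H) ⟩  ≡⟨ expand aliceWins bobWins trail-H ⟩
    a′ + (b + b + s)                                    ≡⟨ cong (λ b → a′ + (b + b + s)) (#bobWins n) ⟩
    a′ + (a + R + (a + R) + s)                          ≡⟨ regroup a′ a R s ⟩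
    a′ + (R + s) + (a + a + R)                          ∎)

-- Combination of the two counts

-- The term m = 0 is the single path of (1,1) steps; `central-double` extracts a 2 from every other
-- term.
N-nontrivialTies : ∀ n → N S₀ n n ≡ suc (2 * nontrivialTies n)
N-nontrivialTies n = begin
  N S₀ n n
    ≡⟨ N-diagonal n ⟩
  ∑ (upTo (suc (n + n))) (λ m → ((m + m) C m) * shift (m + m) (_C m) n)
    ≡⟨ ∑-upTo-suc (n + n) (λ m → ((m + m) C m) * shift (m + m) (_C m) n) ⟩
  suc (∑ (upTo (n + n)) (λ r → ((suc r + suc r) C suc r) * s r))
    ≡⟨ cong suc (∑-cong (upTo (n + n)) λ r →
         trans (cong (_* s r) (central-double r)) (*-assoc 2 ((suc r + r) C r) (s r))) ⟩
  suc (∑ (upTo (n + n)) (λ r → 2 * (((suc r + r) C r) * s r)))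
    ≡⟨ cong suc (∑-*ˡ (upTo (n + n)) 2 _) ⟩
  suc (2 * nontrivialTies n) ∎
  where
  s : ℕ → ℕ
  s r = shift (suc r + suc r) (_C suc r) n

-- The term `r = 0` equals n - 2: it counts the placements of one block HH in front of one of n - 2
-- tails.
nontrivialTies-positive : ∀ n → n ≥ 3 → 1 ≤ nontrivialTies n
nontrivialTies-positive n@(suc (suc (suc k))) (s≤s (s≤s (s≤s _))) = ≤-trans 1≤f0
  (≤-trans (m≤m+n (f 0) _) (≤-reflexive (sym (∑-upTo-suc (suc (suc k) + n) f))))
  where
  f : ℕ → ℕ
  f r = ((suc r + r) C r) * shift (suc r + suc r) (_C suc r) n
  1≤f0 : 1 ≤ f 0
  1≤f0 = ≤-trans (s≤s z≤n) (≤-reflexive (sym (trans (+-identityʳ (suc k C 1)) (nC1≡n (suc k)))))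

-- Since `_/_` reduces fractions, the cross-multiplication takes place in the unnormalised
-- rationals, where the difference has denominator d · d.
/-difference : ∀ i j k d e .{{_ : NonZero d}} .{{_ : NonZero e}} →
               (i -ℤ j) *ℤ + e ≡ k *ℤ + d → i / d - j / d ≡ k / e
/-difference i j k (suc d) (suc e) eq = ℚ.toℚᵘ-injective (begin-equality
  toℚᵘ (i / suc d - j / suc d)                  ≃⟨ ℚ.toℚᵘ-homo-+ (i / suc d) (-ℚ (j / suc d)) ⟩
  toℚᵘ (i / suc d) +ᵘ toℚᵘ (-ℚ (j / suc d))     ≃⟨ ℚᵘ.+-cong (ℚ.toℚᵘ-fromℚᵘ (mkℚᵘ i d))
                                                     (ℚᵘ.≃-trans (ℚ.toℚᵘ-homo‿- (j / suc d)) (ℚᵘ.-‿cong (ℚ.toℚᵘ-fromℚᵘ (mkℚᵘ j d)))) ⟩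
  mkℚᵘ i d +ᵘ -ᵘ mkℚᵘ j d                       ≃⟨ *≡* cross ⟩
  mkℚᵘ k e                                      ≃⟨ ℚ.toℚᵘ-fromℚᵘ (mkℚᵘ k e) ⟨
  toℚᵘ (k / suc e)                              ∎ᵘ)
  where
  open ℚᵘ.≤-Reasoning using (begin-equality_; step-≃-⟩; step-≃-⟨) renaming (_∎ to _∎ᵘ)
  factor : ∀ i j d e → (i *ℤ d +ℤ (-ℤ j) *ℤ d) *ℤ e ≡ ((i -ℤ j) *ℤ e) *ℤ d
  factor = ℤ-Solver.solve-∀
  cross : (i *ℤ + suc d +ℤ (-ℤ j) *ℤ + suc d) *ℤ + suc e ≡ k *ℤ + (suc d * suc d)
  cross = trans (factor i j (+ suc d) (+ suc e)) (trans (cong (_*ℤ + suc d) eq)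
    (trans (ℤ.*-assoc k (+ suc d) (+ suc d)) (cong (k *ℤ_) (sym (ℤ.pos-* (suc d) (suc d))))))

-- Both sides equal R / 2^n: Bob's surplus of wins is R, and N(n, n) - 1 is 2 R.
Δ-formula : ∀ n → Δ n ≡ (+ N S₀ n n -ℤ 1ℤ) /2^ (n + 1)
Δ-formula n = /-difference (+ #B) (+ #A) (+ N S₀ n n -ℤ 1ℤ) (2 ^ n) (2 ^ (n + 1))
  {{m^n≢0 2 n}} {{m^n≢0 2 (n + 1)}} (begin
    (+ #B -ℤ + #A) *ℤ + (2 ^ (n + 1))
      ≡⟨ cong₂ (λ b e → (+ b -ℤ + #A) *ℤ + e) B≡ (cong (2 ^_) (+-comm n 1)) ⟩
    (+ #A +ℤ + R -ℤ + #A) *ℤ + (2 * 2 ^ n)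
      ≡⟨ cong ((+ #A +ℤ + R -ℤ + #A) *ℤ_) (ℤ.pos-* 2 (2 ^ n)) ⟩
    (+ #A +ℤ + R -ℤ + #A) *ℤ (+ 2 *ℤ + (2 ^ n))
      ≡⟨ cancel (+ #A) (+ R) (+ (2 ^ n)) ⟩
    (1ℤ +ℤ + 2 *ℤ + R -ℤ 1ℤ) *ℤ + (2 ^ n)
      ≡⟨ cong (λ z → (1ℤ +ℤ z -ℤ 1ℤ) *ℤ + (2 ^ n)) (ℤ.pos-* 2 R) ⟨
    (+ suc (2 * R) -ℤ 1ℤ) *ℤ + (2 ^ n)
      ≡⟨ cong (λ k → (+ k -ℤ 1ℤ) *ℤ + (2 ^ n)) (N-nontrivialTies n) ⟨
    (+ N S₀ n n -ℤ 1ℤ) *ℤ + (2 ^ n) ∎)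
  where
  #A #B R : ℕ
  #A = count (λ x → bob x <? alice x) (flips n)
  #B = count (λ x → alice x <? bob x) (flips n)
  R = nontrivialTies n
  B≡ : #B ≡ #A + R
  B≡ = trans (count-flips n (λ a b → a <? b))
    (trans (#bobWins n) (cong (_+ R) (sym (count-flips n (λ a b → b <? a)))))
  cancel : ∀ a r p → (a +ℤ r -ℤ a) *ℤ (+ 2 *ℤ p) ≡ (1ℤ +ℤ + 2 *ℤ r -ℤ 1ℤ) *ℤ p
  cancel = ℤ-Solver.solve-∀

Δ-positive : ∀ n → n ≥ 3 → 0ℚ < Δ n
Δ-positive n n≥3 = subst (0ℚ <_) (sym Δ≡) (positive (nontrivialTies-positive n n≥3))
  where
  Δ≡ : Δ n ≡ + (2 * nontrivialTies n) /2^ (n + 1)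
  -- Here `+ suc (2 * R) -ℤ 1ℤ`, with R standing for `nontrivialTies n`, computes to `+ (2 * R)`.
  Δ≡ = trans (Δ-formula n) (cong (λ k → (+ k -ℤ 1ℤ) /2^ (n + 1)) (N-nontrivialTies n))
  positive : ∀ {r} → 1 ≤ r → 0ℚ < + (2 * r) /2^ (n + 1)
  positive {suc r} _ = ℚ.positive⁻¹ _
    {{ℚ.normalize-pos (2 * suc r) (2 ^ (n + 1)) {{m^n≢0 2 (n + 1)}}}}

mainTheorem13 : ((n : ℕ) → Δ n ≡ (+ N S₀ n n -ℤ 1ℤ) /2^ (n + 1)) ×
    ((n : ℕ) → n ≥ 3 → 0ℚ < Δ n)
mainTheorem13 = Δ-formula , Δ-positive
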